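{- Let $k\ge 1$ and $p\ge 2k$ be integers such that the Kneser graph $KG_{p,k}$ is connected. Then $$S_1(KG_{p,k})=2\,W(KG_{p,k})\binom{p-k}{k}$$ and $$S_2(KG_{p,k})=\binom{p-k}{k}\cdot\frac{2\,(W(KG_{p,k}))^2}{\binom{p}{k}}.$$
   Context: The Kneser graph $KG_{p,k}$ has as vertices the $k$-element subsets of a set of $p$ elements, two vertices being adjacent if and only if the corresponding subsets are disjoint. For a finite connected simple graph $G$, $d_G(u,v)$ is the shortest-path distance, $\sigma_G(u)=\sum_{v\in V(G)}d_G(u,v)$ is the status of $u$, and $W(G)=\sum_{\{u,v\}\subseteq V(G)}d_G(u,v)$ is the Wiener index. The status connectivity indices are $S_1(G)=\sum_{uv\in E(G)}[\sigma_G(u)+\sigma_G(v)]$ and $S_2(G)=\sum_{uv\in E(G)}\sigma_G(u)\sigma_G(v)$. -}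

module Defs where

open import Data.Bool.Properties using () renaming (_≟_ to _≟ᵇ_)
open import Data.Empty using (⊥-elim)
open import Data.Fin.Subset using (Subset; Empty; _∩_; ∣_∣; inside; outside)
open import Data.Fin.Subset.Properties using (nonempty?; ∩-comm; ∩-idem)
open import Data.List.Base using (List; []; _∷_; [_]; _++_; map; filter)
open import Data.List.Membership.Propositional using (_∈_; lose)
open import Data.List.Membership.Propositional.Properties
  using (∈-map⁺; ∈-map⁻; ∈-++⁺ˡ; ∈-++⁺ʳ)
open import Data.List.Relation.Unary.All using ([])
open import Data.List.Relation.Unary.AllPairs using ([]; _∷_)
open import Data.List.Relation.Unary.Any using (Any; any?; satisfied) renaming (here to hereₗ)
open import Data.List.Relation.Unary.Unique.Propositional using (Unique)
open import Data.List.Relation.Unary.Unique.Propositional.Properties using (map⁺; ++⁺)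
import Data.List.Relation.Unary.Unique.DecPropositional as DecUnique
open import Data.Nat.Base
  using (ℕ; zero; suc; _+_; _*_; _∸_; _≤_; _<_; z≤n; s≤s; _!; NonZero; >-nonZero)
open import Data.Nat.Combinatorics using (_C_; nCk≡n!/k![n-k]!; [n∸k]!k!∣n!)
open import Data.Nat.Divisibility using (_∣_; ∣⇒≤)
open import Data.Nat.DivMod using (m≥n⇒m/n>0)
open import Data.Nat.ListAction using (sum)
open import Data.Nat.Properties
  using (≤-trans; m≤m+n; *-comm; ≡-irrelevant; _!≢0; _!*_!≢0)
open import Data.Product.Base using (Σ; ∃; _×_; _,_; proj₁; proj₂)
open import Data.Product.Properties using () renaming (≡-dec to Σ-≡-dec)
open import Data.Vec.Base using ([]; _∷_; here; there)
open import Data.Vec.Properties using () renaming (≡-dec to Vec-≡-dec)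
open import Level using (0ℓ)
open import Relation.Binary.Core using (Rel)
open import Relation.Binary.Definitions using (DecidableEquality; Decidable; Symmetric)
open import Relation.Binary.PropositionalEquality
  using (_≡_; refl; sym; cong; subst)
open import Relation.Nullary.Decidable using (Dec; yes; no; map′; ¬?; _×-dec_)
open import Relation.Nullary.Negation using (¬_)
import Relation.Unary as U

record FiniteSimpleGraph : Set₁ where
  infix 4 _~_
  field
    Vertex   : Set
    _≟_      : DecidableEquality Vertex
    vertices : List Vertex
    complete : ∀ v → v ∈ vertices
    unique   : Unique vertices
    _~_      : Rel Vertex 0ℓ
    _~?_     : Decidable _~_
    ~-sym    : Symmetric _~_
    ~-irrefl : ∀ {v} → ¬ (v ~ v)

-- For a duplicate-free list, every two-element subset {x , y} of its
-- entries is listed exactly once, with x occurring before y.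
pairs : ∀ {A : Set} → List A → List (A × A)
pairs []       = []
pairs (x ∷ xs) = map (x ,_) xs ++ pairs xs

least : ∀ {P : U.Pred ℕ 0ℓ} → U.Decidable P → ∀ n → P n →
        ∃ λ l → P l × (∀ m → P m → l ≤ m)
least P? zero p = zero , p , λ _ _ → z≤n
least {P} P? (suc n) p with P? zero
... | yes p₀ = zero , p₀ , λ _ _ → z≤n
... | no ¬p₀ with least {λ m → P (suc m)} (λ m → P? (suc m)) n p
...   | l , pl , minimal = suc l , pl ,
        λ { zero p₀ → ⊥-elim (¬p₀ p₀) ; (suc m) pm → s≤s (minimal m pm) }

module _ (G : FiniteSimpleGraph) where
  open FiniteSimpleGraph G

  data Walk : ℕ → Rel Vertex 0ℓ where
    nil  : ∀ {v} → Walk 0 v v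
    cons : ∀ {n u v w} → u ~ v → Walk n v w → Walk (suc n) u w

  visited : ∀ {n u v} → Walk n u v → List Vertex
  visited (nil {v})          = [ v ]
  visited (cons {u = u} _ w) = u ∷ visited w

  Path : ℕ → Rel Vertex 0ℓ
  Path n u v = Σ (Walk n u v) λ w → Unique (visited w)

  Connected : Set
  Connected = ∀ u v → ∃ λ n → Path n u v

  walk? : ∀ n u v {P : U.Pred (List Vertex) 0ℓ} → U.Decidable P →
          Dec (Σ (Walk n u v) λ w → P (visited w))
  walk? zero u v P? with u ≟ v
  ... | no u≢v   = no λ { (nil , _) → u≢v refl }
  ... | yes refl = map′ (nil ,_) (λ { (nil , p) → p }) (P? [ v ])
  walk? (suc n) u v {P} P? = map′ to from (any? Q? vertices)
    where
    Q : U.Pred Vertex 0ℓ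
    Q x = u ~ x × Σ (Walk n x v) λ w → P (u ∷ visited w)

    Q? : U.Decidable Q
    Q? x = (u ~? x) ×-dec walk? n x v (λ xs → P? (u ∷ xs))

    to : Any Q vertices → Σ (Walk (suc n) u v) λ w → P (visited w)
    to found with satisfied found
    ... | _ , u~x , w , p = cons u~x w , p

    from : (Σ (Walk (suc n) u v) λ w → P (visited w)) → Any Q vertices
    from (cons {v = x} u~x w , p) = lose (complete x) (u~x , w , p)

  path? : ∀ n u v → Dec (Path n u v)
  path? n u v = walk? n u v (DecUnique.unique? _≟_)

  shortest : Connected → ∀ u v →
             ∃ λ n → Path n u v × (∀ m → Path m u v → n ≤ m)
  shortest conn u v = least (λ n → path? n u v) (proj₁ (conn u v)) (proj₂ (conn u v))

  -- Adjacency is symmetric, so each undirected edge is listed exactly once.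
  edges : List (Vertex × Vertex)
  edges = filter (λ (u , v) → u ~? v) (pairs vertices)

  module _ (conn : Connected) where

    -- By minimality the value does not depend on conn.
    distance : Vertex → Vertex → ℕ
    distance u v = proj₁ (shortest conn u v)

    status : Vertex → ℕ
    status u = sum (map (distance u) vertices)

    wienerIndex : ℕ
    wienerIndex = sum (map (λ (u , v) → distance u v) (pairs vertices))

    S₁ : ℕ
    S₁ = sum (map (λ (u , v) → status u + status v) edges)

    S₂ : ℕ
    S₂ = sum (map (λ (u , v) → status u * status v) edges)

KSubset : ℕ → ℕ → Set
KSubset p k = Σ (Subset p) λ s → ∣ s ∣ ≡ k

with-zero : ∀ {p k} → KSubset p k → KSubset (suc p) (suc k)
with-zero (s , eq) = inside ∷ s , cong suc eq

without-zero : ∀ {p k} → KSubset p k → KSubset (suc p) k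
without-zero (s , eq) = outside ∷ s , eq

kSubsets : ∀ p k → List (KSubset p k)
kSubsets zero    zero    = [ [] , refl ]
kSubsets zero    (suc k) = []
kSubsets (suc p) zero    = map without-zero (kSubsets p zero)
kSubsets (suc p) (suc k) =
  map with-zero (kSubsets p k) ++ map without-zero (kSubsets p (suc k))

KSubset-≡ : ∀ {p k} {s t : KSubset p k} → proj₁ s ≡ proj₁ t → s ≡ t
KSubset-≡ {s = s , eq} {.s , eq′} refl = cong (s ,_) (≡-irrelevant eq eq′)

_≟ˢ_ : ∀ {p k} → DecidableEquality (KSubset p k)
_≟ˢ_ = Σ-≡-dec (Vec-≡-dec _≟ᵇ_) λ eq eq′ → yes (≡-irrelevant eq eq′)

kSubsets-complete : ∀ p k (s : KSubset p k) → s ∈ kSubsets p k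
kSubsets-complete zero    zero    ([] , refl)          = hereₗ refl
kSubsets-complete (suc p) zero    (outside ∷ s , eq)   =
  ∈-map⁺ without-zero (kSubsets-complete p zero (s , eq))
kSubsets-complete (suc p) (suc k) (inside ∷ s , refl)  =
  ∈-++⁺ˡ (∈-map⁺ with-zero (kSubsets-complete p k (s , refl)))
kSubsets-complete (suc p) (suc k) (outside ∷ s , eq)   =
  ∈-++⁺ʳ (map with-zero (kSubsets p k))
    (∈-map⁺ without-zero (kSubsets-complete p (suc k) (s , eq)))

with-zero-injective : ∀ {p k} {s t : KSubset p k} → with-zero s ≡ with-zero t → s ≡ t
with-zero-injective eq with cong proj₁ eq
... | refl = KSubset-≡ refl

without-zero-injective : ∀ {p k} {s t : KSubset p k} →
                         without-zero s ≡ without-zero t → s ≡ t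
without-zero-injective eq with cong proj₁ eq
... | refl = KSubset-≡ refl

kSubsets-unique : ∀ p k → Unique (kSubsets p k)
kSubsets-unique zero    zero    = [] ∷ []
kSubsets-unique zero    (suc k) = []
kSubsets-unique (suc p) zero    = map⁺ without-zero-injective (kSubsets-unique p zero)
kSubsets-unique (suc p) (suc k) =
  ++⁺ (map⁺ with-zero-injective (kSubsets-unique p k))
      (map⁺ without-zero-injective (kSubsets-unique p (suc k)))
      λ (i , j) → disjoint (∈-map⁻ with-zero i) (∈-map⁻ without-zero j)
  where
  disjoint : ∀ {s : KSubset (suc p) (suc k)}
               {xs : List (KSubset p k)} {ys : List (KSubset p (suc k))} →
             ∃ (λ x → x ∈ xs × s ≡ with-zero x) →
             ¬ ∃ (λ y → y ∈ ys × s ≡ without-zero y)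
  disjoint (_ , _ , refl) (_ , _ , ())

Disjoint : ∀ {p k} → Rel (KSubset p k) 0ℓ
Disjoint (s , _) (t , _) = Empty (s ∩ t)

nonempty : ∀ {p} (s : Subset p) → 1 ≤ ∣ s ∣ → ¬ Empty s
nonempty (inside  ∷ s) _   e = e (_ , here)
nonempty (outside ∷ s) 1≤n e = nonempty s 1≤n λ (i , i∈s) → e (_ , there i∈s)

-- For k = 0 the empty set would be adjacent to itself, hence 1 ≤ k.
KG : ∀ p k → 1 ≤ k → FiniteSimpleGraph
KG p k 1≤k = record
  { Vertex   = KSubset p k
  ; _≟_      = _≟ˢ_
  ; vertices = kSubsets p k
  ; complete = kSubsets-complete p k
  ; unique   = kSubsets-unique p k
  ; _~_      = Disjoint
  ; _~?_     = λ (s , _) (t , _) → ¬? (nonempty? (s ∩ t))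
  ; ~-sym    = λ { {s , _} {t , _} → subst Empty (∩-comm s t) }
  ; ~-irrefl = λ { {s , refl} e → nonempty s 1≤k (subst Empty (∩-idem s) e) }
  }

C-nonZero : ∀ p k → 2 * k ≤ p → NonZero (p C k)
C-nonZero p k 2k≤p =
  >-nonZero (subst (0 <_) (sym (nCk≡n!/k![n-k]! k≤p)) (m≥n⇒m/n>0 (∣⇒≤ divisor)))
  where
  k≤p : k ≤ p
  k≤p = ≤-trans (m≤m+n k (k + 0)) 2k≤p
  instance
    _ = k !* (p ∸ k) !≢0
    _ = p !≢0
  divisor : k ! * (p ∸ k) ! ∣ p !
  divisor = subst (_∣ p !) (*-comm ((p ∸ k) !) (k !)) ([n∸k]!k!∣n! k≤p)

{-# OPTIONS --safe #-}

-- Permuting the p points acts on KG_{p,k} by automorphisms, and transitively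
-- on the k-subsets, so every vertex has the same status c; every vertex has
-- degree D = C(p−k,k), since its neighbours are the k-subsets of its
-- complement.  With N = C(p,k) vertices, double counting gives 2 W = N c and
-- 2 |E| = N D, hence S₁ = 2 |E| c = 2 W D and
-- N S₂ = N |E| c² = D (N c)² / 2 = 2 D W².

module Submission where

open import Defs
open import Data.Nat.Base using (ℕ; _*_; _∸_; _^_; _≤_)
open import Data.Nat.Combinatorics using (_C_)
open import Data.Integer.Base using (+_)
open import Data.Rational.Base using (_/_) renaming (_*_ to _*ℚ_)
open import Data.Product.Base using (_×_)
open import Relation.Binary.PropositionalEquality using (_≡_)

open import Data.Bool.Base using (true; false; if_then_else_; _∧_)
open import Data.Empty using (⊥-elim)
open import Data.Fin.Base using (suc)
open import Data.Fin.Subset as Subset using (Subset; Empty; _∩_; ∣_∣; inside; outside)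
open import Data.Fin.Subset.Properties
  using (nonempty?; drop-∷-Empty; Empty-unique; ∣⊥∣≡0; ∣p∣≤n; ∩-idem; ∩-zeroˡ; ∉⊥)
open import Data.Integer.Base using () renaming (_*_ to _*ℤ_)
open import Data.Integer.Properties using (pos-*)
open import Data.List.Base using (List; []; _∷_; _++_; _∷ʳ_; map; filter; length; reverse)
open import Data.List.Membership.Propositional using (_∈_)
open import Data.List.Membership.Propositional.Properties using (∈-map⁺)
open import Data.List.Membership.Propositional.Properties.WithK using (unique∧set⇒bag)
open import Data.List.Properties
  using (map-++; map-∘; map-cong; length-++; filter-++; filter-all; filter-none;
         unfold-reverse)
open import Data.List.Relation.Binary.BagAndSetEquality using (∼bag⇒↭)
open import Data.List.Relation.Binary.Permutation.Propositional using (_↭_; ↭-sym; ↭⇒↭ₛ)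
import Data.List.Relation.Binary.Permutation.Propositional.Properties as ↭
open import Data.List.Relation.Binary.Permutation.Setoid.Properties using (Unique-resp-↭)
open import Data.List.Relation.Unary.All using (universal; [])
import Data.List.Relation.Unary.All.Properties as All
open import Data.List.Relation.Unary.AllPairs using ([]; _∷_)
open import Data.List.Relation.Unary.Unique.Propositional using (Unique)
open import Data.List.Relation.Unary.Unique.Propositional.Properties using (map⁺)
open import Data.Nat.Base using (zero; suc; _+_; NonZero; z≤n)
open import Data.Nat.Combinatorics using (nCk≡nC[n∸k]; nCn≡1; nCk+nC[k+1]≡[n+1]C[k+1])
open import Data.Nat.ListAction using (sum)
open import Data.Nat.ListAction.Properties using (sum-++; sum-↭)
open import Data.Nat.Properties
  using (*-identityˡ; *-identityʳ; *-cancelˡ-≡; +-∸-assoc; ≤-antisym; n≤0⇒n≡0; suc-injective)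
open import Data.Nat.Tactic.RingSolver using (solve-∀)
open import Data.Product.Base using (∃; _,_; proj₁; proj₂; uncurry)
open import Data.Rational.Properties using (toℚᵘ-injective; toℚᵘ-homo-*; toℚᵘ-fromℚᵘ)
open import Data.Rational.Unnormalised.Base using (mkℚᵘ; *≡*)
import Data.Rational.Unnormalised.Properties as ℚᵘ
open import Data.Vec.Base using ([]; _∷_; here; there)
open import Function.Base using (_∘_; _$_)
open import Function.Bundles using (mk⇔; _↔_; Inverse; mk↔ₛ′)
open import Function.Construct.Composition using (_↔-∘_)
open import Function.Construct.Identity using (↔-id)
open import Function.Construct.Symmetry using (↔-sym)
open import Level using (0ℓ)
open import Relation.Binary.PropositionalEquality
  using (refl; sym; trans; cong; cong₂; subst; subst₂; setoid; module ≡-Reasoning)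
open import Relation.Nullary.Decidable using (Dec; yes; no; does; ¬?)
open import Relation.Nullary.Negation using (¬_)
open import Relation.Unary using (Pred; Decidable; _≐_)

open ≡-Reasoning

private
  variable
    A B : Set

-- Sums and counts over lists

sum-map-const : ∀ {f : A → ℕ} {c} → (∀ x → f x ≡ c) → ∀ xs → sum (map f xs) ≡ length xs * c
sum-map-const f≡c []       = refl
sum-map-const f≡c (x ∷ xs) = cong₂ _+_ (f≡c x) (sum-map-const f≡c xs)

sum-map-+ : ∀ (f g : A → ℕ) xs →
            sum (map (λ x → f x + g x) xs) ≡ sum (map f xs) + sum (map g xs)
sum-map-+ f g []       = refl
sum-map-+ f g (x ∷ xs) = trans (cong (λ r → f x + g x + r) (sum-map-+ f g xs)) (lemma (f x) (g x) _ _)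
  where
  lemma : ∀ a b c d → a + b + (c + d) ≡ a + c + (b + d)
  lemma = solve-∀

-- The diagonal contributes nothing, and every unordered pair is met once in each order. Peeling off
-- `x` removes a row and a column, which agree by symmetry. Applied to distances and to adjacency.
sum-sum≡2*sum-pairs : ∀ (f : A → A → ℕ) → (∀ x y → f x y ≡ f y x) → (∀ x → f x x ≡ 0) → ∀ xs →
  sum (map (λ x → sum (map (f x) xs)) xs) ≡ 2 * sum (map (uncurry f) (pairs xs))
sum-sum≡2*sum-pairs f f-sym f-diag []       = refl
sum-sum≡2*sum-pairs f f-sym f-diag (x ∷ xs) = begin
  (f x x + row) + sum (map (λ y → f y x + sum (map (f y) xs)) xs)
    ≡⟨ cong₂ _+_ (cong (_+ row) (f-diag x)) (sum-map-+ (λ y → f y x) _ xs) ⟩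
  row + (sum (map (λ y → f y x) xs) + sum (map (λ y → sum (map (f y) xs)) xs))
    ≡⟨ cong (λ r → row + r) (cong₂ _+_ (cong sum (map-cong (λ y → f-sym y x) xs))
                                 (sum-sum≡2*sum-pairs f f-sym f-diag xs)) ⟩
  row + (row + 2 * rest)
    ≡⟨ lemma row rest ⟩
  2 * (row + rest)
    ≡⟨ cong (λ r → 2 * (r + rest)) (cong sum (map-∘ xs)) ⟩
  2 * (sum (map (uncurry f) (map (x ,_) xs)) + rest)
    ≡⟨ cong (2 *_) (sum-++ (map (uncurry f) (map (x ,_) xs)) _) ⟨
  2 * sum (map (uncurry f) (map (x ,_) xs) ++ map (uncurry f) (pairs xs))
    ≡⟨ cong (λ ys → 2 * sum ys) (map-++ (uncurry f) (map (x ,_) xs) (pairs xs)) ⟨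
  2 * sum (map (uncurry f) (map (x ,_) xs ++ pairs xs)) ∎
  where
  row  = sum (map (f x) xs)
  rest = sum (map (uncurry f) (pairs xs))
  lemma : ∀ a b → a + (a + 2 * b) ≡ 2 * (a + b)
  lemma = solve-∀

-- Turns the count of edges into a sum, so that the double counting used for distances covers it
-- too.
indicator : {P : Set} → Dec P → ℕ
indicator P? = if does P? then 1 else 0

indicator-cong : {P Q : Set} → (P → Q) → (Q → P) → (P? : Dec P) (Q? : Dec Q) →
                 indicator P? ≡ indicator Q?
indicator-cong f g (yes p) (yes q) = refl
indicator-cong f g (yes p) (no ¬q) = ⊥-elim (¬q (f p))
indicator-cong f g (no ¬p) (yes q) = ⊥-elim (¬p (g q))
indicator-cong f g (no ¬p) (no ¬q) = refl

indicator-no : {P : Set} → ¬ P → (P? : Dec P) → indicator P? ≡ 0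
indicator-no ¬p (yes p) = ⊥-elim (¬p p)
indicator-no ¬p (no _)  = refl

length-filter≡sum : ∀ {P : Pred A 0ℓ} (P? : Decidable P) xs →
                    length (filter P? xs) ≡ sum (map (indicator ∘ P?) xs)
length-filter≡sum P? []       = refl
length-filter≡sum P? (x ∷ xs) with P? x
... | yes _ = cong suc (length-filter≡sum P? xs)
... | no _  = length-filter≡sum P? xs

length-filter-map : ∀ {P : Pred B 0ℓ} {Q : Pred A 0ℓ} (P? : Decidable P) (Q? : Decidable Q)
                    (f : A → B) → P ∘ f ≐ Q → ∀ xs →
                    length (filter P? (map f xs)) ≡ length (filter Q? xs)
length-filter-map P? Q? f P≐Q []       = refl
length-filter-map P? Q? f P≐Q (x ∷ xs) with P? (f x) | Q? x
... | yes _ | yes _ = cong suc (length-filter-map P? Q? f P≐Q xs)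
... | yes p | no ¬q = ⊥-elim (¬q (proj₁ P≐Q p))
... | no ¬p | yes q = ⊥-elim (¬p (proj₂ P≐Q q))
... | no _  | no _  = length-filter-map P? Q? f P≐Q xs

head-of-nonempty : (xs : List A) → NonZero (length xs) → A
head-of-nonempty (x ∷ _) _ = x

Unique-reverse : {xs : List A} → Unique xs → Unique (reverse xs)
Unique-reverse {xs = xs} = Unique-resp-↭ (setoid _) (↭⇒↭ₛ (↭-sym (↭.↭-reverse xs)))

-- Distance and automorphisms

module _ (G : FiniteSimpleGraph) where
  open FiniteSimpleGraph G

  snoc : ∀ {n u v w} → Walk G n u v → v ~ w → Walk G (suc n) u w
  snoc nil        v~w = cons v~w nil
  snoc (cons e p) v~w = cons e (snoc p v~w)

  visited-snoc : ∀ {n u v w} (p : Walk G n u v) (e : v ~ w) →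
                 visited G (snoc p e) ≡ visited G p ∷ʳ w
  visited-snoc nil        e = refl
  visited-snoc (cons _ p) e = cong (_ ∷_) (visited-snoc p e)

  reverseWalk : ∀ {n u v} → Walk G n u v → Walk G n v u
  reverseWalk nil        = nil
  reverseWalk (cons e p) = snoc (reverseWalk p) (~-sym e)

  -- A `Path` demands a duplicate-free `visited` list; reversing the list keeps it so, and reversed
  -- walks are again paths.
  visited-reverse : ∀ {n u v} (p : Walk G n u v) →
                    visited G (reverseWalk p) ≡ reverse (visited G p)
  visited-reverse nil                = refl
  visited-reverse (cons {u = u} e p) = begin
    visited G (snoc (reverseWalk p) (~-sym e)) ≡⟨ visited-snoc (reverseWalk p) (~-sym e) ⟩
    visited G (reverseWalk p) ∷ʳ u             ≡⟨ cong (_∷ʳ u) (visited-reverse p) ⟩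
    reverse (visited G p) ∷ʳ u                 ≡⟨ unfold-reverse u (visited G p) ⟨
    reverse (u ∷ visited G p)                  ∎

  reversePath : ∀ {n u v} → Path G n u v → Path G n v u
  reversePath (p , p!) =
    reverseWalk p , subst Unique (sym (visited-reverse p)) (Unique-reverse p!)

  -- Adjacency is preserved in both directions by assumption, so `inverse` merely exchanges the two
  -- fields.
  record Automorphism : Set where
    field
      bijection : Vertex ↔ Vertex
    open Inverse bijection public using (to; from; strictlyInverseˡ; strictlyInverseʳ)
    field
      to-~   : ∀ {u v} → u ~ v → to u ~ to v
      from-~ : ∀ {u v} → u ~ v → from u ~ from v

    to-injective : ∀ {u v} → to u ≡ to v → u ≡ v
    to-injective {u} {v} eq =
      trans (sym (strictlyInverseʳ u)) (trans (cong from eq) (strictlyInverseʳ v))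

    mapWalk : ∀ {n u v} → Walk G n u v → Walk G n (to u) (to v)
    mapWalk nil        = nil
    mapWalk (cons e p) = cons (to-~ e) (mapWalk p)

    visited-map : ∀ {n u v} (p : Walk G n u v) → visited G (mapWalk p) ≡ map to (visited G p)
    visited-map nil        = refl
    visited-map (cons e p) = cong (_ ∷_) (visited-map p)

    mapPath : ∀ {n u v} → Path G n u v → Path G n (to u) (to v)
    mapPath (p , p!) = mapWalk p , subst Unique (sym (visited-map p)) (map⁺ to-injective p!)

    -- Duplicate-free lists with the same members are permutations of each other. Injectivity keeps
    -- the image duplicate-free; surjectivity makes it contain every vertex.
    vertices↭ : map to vertices ↭ vertices
    vertices↭ = ∼bag⇒↭ (unique∧set⇒bag (map⁺ to-injective unique) unique
      (mk⇔ (λ _ → complete _)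
           (λ _ → subst (_∈ map to vertices) (strictlyInverseˡ _)
                    (∈-map⁺ to (complete (from _))))))

  inverse : Automorphism → Automorphism
  inverse φ = record { bijection = ↔-sym bijection ; to-~ = from-~ ; from-~ = to-~ }
    where open Automorphism φ

  module _ (conn : Connected G) where

    distance-≤ : ∀ {n u v} → Path G n u v → distance G conn u v ≤ n
    distance-≤ {n} {u} {v} p = proj₂ (proj₂ (shortest G conn u v)) n p

    distance-path : ∀ u v → Path G (distance G conn u v) u v
    distance-path u v = proj₁ (proj₂ (shortest G conn u v))

    distance-sym : ∀ u v → distance G conn u v ≡ distance G conn v u
    distance-sym u v = ≤-antisym (distance-≤ (reversePath (distance-path v u)))
                                 (distance-≤ (reversePath (distance-path u v)))

    distance-diag : ∀ u → distance G conn u u ≡ 0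
    distance-diag u = n≤0⇒n≡0 (distance-≤ (nil , [] ∷ []))

    -- The image of a shortest path is a path of the same length, which bounds one side; the inverse
    -- automorphism bounds the other.
    distance-automorphism : ∀ φ u v →
                            distance G conn (Automorphism.to φ u) (Automorphism.to φ v) ≡ distance G conn u v
    distance-automorphism φ u v = ≤-antisym
      (distance-≤ (mapPath (distance-path u v)))
      -- The path pulled back runs from `from (to u)` to `from (to v)`; its endpoints are rewritten
      -- to `u` and `v`.
      (distance-≤ (subst₂ (Path G _) (strictlyInverseʳ u) (strictlyInverseʳ v)
        (Automorphism.mapPath (inverse φ) (distance-path (to u) (to v)))))
      where open Automorphism φ

    -- Replacing the summation variable `v` by `to v` only permutes the summands.
    status-automorphism : ∀ φ u → status G conn (Automorphism.to φ u) ≡ status G conn u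
    status-automorphism φ u = begin
      sum (map (distance G conn (to u)) vertices)
        ≡⟨ sum-↭ (↭.map⁺ (distance G conn (to u)) vertices↭) ⟨
      sum (map (distance G conn (to u)) (map to vertices))
        ≡⟨ cong sum (map-∘ vertices) ⟨
      sum (map (λ v → distance G conn (to u) (to v)) vertices)
        ≡⟨ cong sum (map-cong (distance-automorphism φ u) vertices) ⟩
      sum (map (distance G conn u) vertices) ∎
      where open Automorphism φ

    2*wienerIndex : ∀ {c} → (∀ u → status G conn u ≡ c) →
                    2 * wienerIndex G conn ≡ length vertices * c
    2*wienerIndex status≡c = trans
      (sym (sum-sum≡2*sum-pairs (distance G conn) distance-sym distance-diag vertices))
      (sum-map-const status≡c vertices)

  -- The handshake lemma: the entries of the adjacency matrix are summed by rows and by unordered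
  -- pairs.
  2*edges : ∀ {d} → (∀ u → length (filter (u ~?_) vertices) ≡ d) →
            2 * length (edges G) ≡ length vertices * d
  2*edges degree≡d = begin
    2 * length (edges G)
      ≡⟨ cong (2 *_) (length-filter≡sum (λ (u , v) → u ~? v) (pairs vertices)) ⟩
    2 * sum (map (uncurry adjacent) (pairs vertices))
      ≡⟨ sum-sum≡2*sum-pairs adjacent
           (λ u v → indicator-cong ~-sym ~-sym (u ~? v) (v ~? u))
           (λ u → indicator-no ~-irrefl (u ~? u)) vertices ⟨
    sum (map (λ u → sum (map (adjacent u) vertices)) vertices)
      ≡⟨ sum-map-const
           (λ u → trans (sym (length-filter≡sum (u ~?_) vertices)) (degree≡d u)) vertices ⟩
    length vertices * _ ∎
    where
    adjacent : Vertex → Vertex → ℕ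
    adjacent u v = indicator (u ~? v)

  -- Graphs of constant status and constant degree

  module _ (conn : Connected G) {c d : ℕ}
           (status≡c : ∀ u → status G conn u ≡ c)
           (degree≡d : ∀ u → length (filter (u ~?_) vertices) ≡ d) where

    private
      N = length vertices
      E = length (edges G)
      W = wienerIndex G conn

    S₁-regular : S₁ G conn ≡ 2 * W * d
    S₁-regular = begin
      S₁ G conn   ≡⟨ sum-map-const (λ (u , v) → cong₂ _+_ (status≡c u) (status≡c v)) (edges G) ⟩
      E * (c + c) ≡⟨ double-* E c ⟩
      2 * E * c   ≡⟨ cong (_* c) (2*edges degree≡d) ⟩
      N * d * c   ≡⟨ swap-* N d c ⟩
      N * c * d   ≡⟨ cong (_* d) (2*wienerIndex conn status≡c) ⟨
      2 * W * d   ∎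
      where
      double-* : ∀ e c → e * (c + c) ≡ 2 * e * c
      double-* = solve-∀
      swap-* : ∀ n d c → n * d * c ≡ n * c * d
      swap-* = solve-∀

    -- The factor `N` on the left keeps the identity within the natural numbers; the division by `N`
    -- is left to `/1≡*/`.
    S₂-regular : S₂ G conn * N ≡ d * (2 * W ^ 2)
    -- `E` and `W` are known only through `2 * E` and `2 * W`, so both sides are doubled first.
    S₂-regular = *-cancelˡ-≡ _ _ 2 $ begin
      2 * (S₂ G conn * N)
        ≡⟨ cong (λ s → 2 * (s * N))
             (sum-map-const (λ (u , v) → cong₂ _*_ (status≡c u) (status≡c v)) (edges G)) ⟩
      2 * (E * (c * c) * N)       ≡⟨ pull-2 E c N ⟩
      2 * E * (c * c * N)         ≡⟨ cong (_* (c * c * N)) (2*edges degree≡d) ⟩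
      N * d * (c * c * N)         ≡⟨ regroup N d c ⟩
      d * ((N * c) * (N * c))     ≡⟨ cong (λ x → d * (x * x)) (2*wienerIndex conn status≡c) ⟨
      d * ((2 * W) * (2 * W))     ≡⟨ square d W ⟩
      2 * (d * (2 * W ^ 2))       ∎
      where
      pull-2 : ∀ e c n → 2 * (e * (c * c) * n) ≡ 2 * e * (c * c * n)
      pull-2 = solve-∀
      regroup : ∀ n d c → n * d * (c * c * n) ≡ d * ((n * c) * (n * c))
      regroup = solve-∀
      -- `w * (w * 1)` is the unfolding of `w ^ 2`.
      square : ∀ d w → d * ((2 * w) * (2 * w)) ≡ 2 * (d * (2 * (w * (w * 1))))
      square = solve-∀

-- Symmetries of the family of subsets

-- Stands in for a permutation of the points, given by its action on subsets. Sizes of intersections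
-- determine disjointness and, taking `s = t`, cardinality.
record Symmetry (p : ℕ) : Set where
  field
    bijection : Subset p ↔ Subset p
  open Inverse bijection public using (to; from; strictlyInverseˡ; strictlyInverseʳ)
  field
    ∣to∩to∣ : ∀ s t → ∣ to s ∩ to t ∣ ≡ ∣ s ∩ t ∣

  ∣from∩from∣ : ∀ s t → ∣ from s ∩ from t ∣ ≡ ∣ s ∩ t ∣
  ∣from∩from∣ s t = trans (sym (∣to∩to∣ (from s) (from t)))
    (cong₂ (λ s t → ∣ s ∩ t ∣) (strictlyInverseˡ s) (strictlyInverseˡ t))

  ∣to∣ : ∀ s → ∣ to s ∣ ≡ ∣ s ∣
  ∣to∣ s = trans (cong ∣_∣ (sym (∩-idem (to s)))) (trans (∣to∩to∣ s s) (cong ∣_∣ (∩-idem s)))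

infix 4 _≈_

-- The orbit relation of the symmetries.
_≈_ : ∀ {p} → Subset p → Subset p → Set
s ≈ t = ∃ λ φ → Symmetry.to φ s ≡ t

≈-refl : ∀ {p} {s : Subset p} → s ≈ s
≈-refl = record { bijection = ↔-id _ ; ∣to∩to∣ = λ _ _ → refl } , refl

invert : ∀ {p} → Symmetry p → Symmetry p
invert φ = record { bijection = ↔-sym bijection ; ∣to∩to∣ = ∣from∩from∣ }
  where open Symmetry φ

≈-sym : ∀ {p} {s t : Subset p} → s ≈ t → t ≈ s
≈-sym {s = s} (φ , refl) = invert φ , Symmetry.strictlyInverseʳ φ s

≈-trans : ∀ {p} {s t u : Subset p} → s ≈ t → t ≈ u → s ≈ u
≈-trans (φ , refl) (ψ , refl) = record
  { bijection = Symmetry.bijection ψ ↔-∘ Symmetry.bijection φ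
  ; ∣to∩to∣   = λ s t → trans (Symmetry.∣to∩to∣ ψ _ _) (Symmetry.∣to∩to∣ φ s t)
  } , refl

∣∷∣-cong : ∀ {m n} b {s : Subset m} {t : Subset n} →
           ∣ s ∣ ≡ ∣ t ∣ → ∣ b ∷ s ∣ ≡ ∣ b ∷ t ∣
∣∷∣-cong true  eq = cong suc eq
∣∷∣-cong false eq = eq

-- The first point is fixed and `φ` acts on the others. Together with `swap-≈` this yields every
-- adjacent transposition.
∷-≈ : ∀ {p} b {s t : Subset p} → s ≈ t → b ∷ s ≈ b ∷ t
∷-≈ b (φ , refl) = record
  { bijection = mk↔ₛ′ (λ { (x ∷ s) → x ∷ to s }) (λ { (x ∷ s) → x ∷ from s })
                      (λ { (x ∷ s) → cong (x ∷_) (strictlyInverseˡ s) })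
                      (λ { (x ∷ s) → cong (x ∷_) (strictlyInverseʳ s) })
  ; ∣to∩to∣   = λ { (x ∷ s) (y ∷ t) → ∣∷∣-cong (x ∧ y) {to s ∩ to t} {s ∩ t} (∣to∩to∣ s t) }
  } , refl
  where open Symmetry φ

swap-≈ : ∀ {p} a b {s : Subset p} → a ∷ b ∷ s ≈ b ∷ a ∷ s
swap-≈ a b = record
  { bijection = mk↔ₛ′ swap swap swap-swap swap-swap
  ; ∣to∩to∣   = λ { (a ∷ b ∷ s) (c ∷ d ∷ t) → ∣swap∣ (a ∧ c) (b ∧ d) (s ∩ t) }
  } , refl
  where
  swap : ∀ {p} → Subset (suc (suc p)) → Subset (suc (suc p))
  swap (a ∷ b ∷ s) = b ∷ a ∷ s
  swap-swap : ∀ {p} (s : Subset (suc (suc p))) → swap (swap s) ≡ s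
  swap-swap (a ∷ b ∷ s) = refl
  ∣swap∣ : ∀ {p} a b (s : Subset p) → ∣ b ∷ a ∷ s ∣ ≡ ∣ a ∷ b ∷ s ∣
  ∣swap∣ true  true  s = refl
  ∣swap∣ true  false s = refl
  ∣swap∣ false true  s = refl
  ∣swap∣ false false s = refl

-- An element of `s` is bubbled to the front: first to the front of the tail, then past the leading
-- `outside`, which ends up second.
inside-first : ∀ {p m} (s : Subset (suc p)) → ∣ s ∣ ≡ suc m →
               ∃ λ t → s ≈ inside ∷ t × ∣ t ∣ ≡ m
inside-first             (inside  ∷ s) eq = s , ≈-refl , suc-injective eq
inside-first {p = zero}  (outside ∷ []) ()
inside-first {p = suc p} (outside ∷ s) eq with inside-first s eq
... | t , s≈ , ∣t∣≡m =
  outside ∷ t , ≈-trans (∷-≈ outside s≈) (swap-≈ outside inside) , ∣t∣≡m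

-- Transitivity on subsets of equal size, by induction on `p`: equal heads are fixed, and unequal
-- heads are left to `∣∣≡⇒≈-differ`.
∣∣≡⇒≈ : ∀ {p} (s t : Subset p) → ∣ s ∣ ≡ ∣ t ∣ → s ≈ t

-- As `t` is nonempty, `t ≈ inside ∷ u` with `u` of the size of `s`. The chain is `inside ∷ s`,
-- `inside ∷ outside ∷ u`, `outside ∷ inside ∷ u`, `outside ∷ t`.
∣∣≡⇒≈-differ : ∀ {p} (s t : Subset p) → suc ∣ s ∣ ≡ ∣ t ∣ → inside ∷ s ≈ outside ∷ t
∣∣≡⇒≈-differ {suc p} s t eq = let u , t≈ , ∣u∣≡ = inside-first t (sym eq) in
  ≈-trans (∷-≈ inside (∣∣≡⇒≈ {suc p} s (outside ∷ u) (sym ∣u∣≡)))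
    (≈-trans (swap-≈ inside outside) (∷-≈ outside (≈-sym t≈)))
∣∣≡⇒≈-differ {zero} [] [] ()

∣∣≡⇒≈ {zero}  []            []            eq = ≈-refl
∣∣≡⇒≈ {suc p} (inside  ∷ s) (inside  ∷ t) eq = ∷-≈ inside (∣∣≡⇒≈ {p} s t (suc-injective eq))
∣∣≡⇒≈ {suc p} (outside ∷ s) (outside ∷ t) eq = ∷-≈ outside (∣∣≡⇒≈ {p} s t eq)
∣∣≡⇒≈ {suc p} (inside  ∷ s) (outside ∷ t) eq = ∣∣≡⇒≈-differ {p} s t eq
∣∣≡⇒≈ {suc p} (outside ∷ s) (inside  ∷ t) eq = ≈-sym (∣∣≡⇒≈-differ {p} t s (sym eq))

Empty⇒∣∣≡0 : ∀ {p} (s : Subset p) → Empty s → ∣ s ∣ ≡ 0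
Empty⇒∣∣≡0 {p} _ e = trans (cong ∣_∣ (Empty-unique e)) (∣⊥∣≡0 p)

∷-Empty : ∀ {p} {s : Subset p} → Empty s → Empty (outside ∷ s)
∷-Empty e (suc i , there i∈s) = e (i , i∈s)

∣∣≡0⇒Empty : ∀ {p} (s : Subset p) → ∣ s ∣ ≡ 0 → Empty s
∣∣≡0⇒Empty (outside ∷ s) eq = ∷-Empty (∣∣≡0⇒Empty s eq)
∣∣≡0⇒Empty []            eq (() , _)

-- Kneser graphs

module _ {p k : ℕ} (1≤k : 1 ≤ k) where

  kneserAutomorphism : Symmetry p → Automorphism (KG p k 1≤k)
  kneserAutomorphism φ = record
    { bijection = mk↔ₛ′ (λ (s , eq) → to s , trans (∣to∣ s) eq)
                        (λ (s , eq) → from s , trans (Symmetry.∣to∣ (invert φ) s) eq)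
                        (λ (s , _) → KSubset-≡ (strictlyInverseˡ s))
                        (λ (s , _) → KSubset-≡ (strictlyInverseʳ s))
    -- Disjointness is passed through the size of the intersection, which `φ` preserves.
    ; to-~      = λ { {s , _} {t , _} e →
        ∣∣≡0⇒Empty _ (trans (∣to∩to∣ s t) (Empty⇒∣∣≡0 (s ∩ t) e)) }
    ; from-~    = λ { {s , _} {t , _} e →
        ∣∣≡0⇒Empty _ (trans (∣from∩from∣ s t) (Empty⇒∣∣≡0 (s ∩ t) e)) }
    }
    where open Symmetry φ

  kneser-status : ∀ (conn : Connected (KG p k 1≤k)) u v →
                  status (KG p k 1≤k) conn u ≡ status (KG p k 1≤k) conn v
  kneser-status conn u@(s , ∣s∣≡k) v@(t , ∣t∣≡k) with ∣∣≡⇒≈ s t (trans ∣s∣≡k (sym ∣t∣≡k))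
  ... | φ , φs≡t = begin
    status G conn u        ≡⟨ status-automorphism G conn ψ u ⟨
    status G conn (to u)   ≡⟨ cong (status G conn) (KSubset-≡ φs≡t) ⟩
    status G conn v        ∎
    where
    G = KG p k 1≤k
    ψ = kneserAutomorphism φ
    open Automorphism ψ using (to)

-- Counting the `k`-subsets disjoint from a given set

DisjointFrom : ∀ {p k} → Subset p → Pred (KSubset p k) 0ℓ
DisjointFrom s (t , _) = Empty (s ∩ t)

-- The same test as `_~?_` in `KG`, so filtering by it is definitionally filtering the neighbours of
-- a vertex.
disjointFrom? : ∀ {p k} (s : Subset p) → Decidable (DisjointFrom {p} {k} s)
disjointFrom? s (t , _) = ¬? (nonempty? (s ∩ t))

nC0≡1 : ∀ n → n C 0 ≡ 1
nC0≡1 n = trans (nCk≡nC[n∸k] {n = n} z≤n) (nCn≡1 n)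

-- Induction on the points. If the first point lies in `s`, only sets avoiding it survive; otherwise
-- sets with and without it add up by Pascal's rule. The size of `s` is free, since it changes along
-- the induction and `s = ⊥` is used to count all vertices.
length-disjointFrom : ∀ {p} (s : Subset p) k →
  length (filter (disjointFrom? s) (kSubsets p k)) ≡ (p ∸ ∣ s ∣) C k
length-disjointFrom [] zero    = refl
length-disjointFrom [] (suc k) = refl
length-disjointFrom {suc p} (x ∷ s) zero = begin
  length (filter (disjointFrom? (x ∷ s)) (map without-zero (kSubsets p 0)))
    ≡⟨ length-filter-map (disjointFrom? (x ∷ s)) (disjointFrom? s) without-zero
         (without-zero-disjoint x) (kSubsets p 0) ⟩
  length (filter (disjointFrom? s) (kSubsets p 0)) ≡⟨ length-disjointFrom s 0 ⟩
  (p ∸ ∣ s ∣) C 0                                  ≡⟨ nC0≡1 (p ∸ ∣ s ∣) ⟩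
  1                                                ≡⟨ nC0≡1 (suc p ∸ ∣ x ∷ s ∣) ⟨
  (suc p ∸ ∣ x ∷ s ∣) C 0                          ∎
  where
  without-zero-disjoint : ∀ x → DisjointFrom (x ∷ s) ∘ without-zero ≐ DisjointFrom {k = 0} s
  -- The head `x ∧ outside` of the intersection reduces only once `x` is known, hence two clauses
  -- with one right-hand side.
  without-zero-disjoint inside  = drop-∷-Empty , ∷-Empty
  without-zero-disjoint outside = drop-∷-Empty , ∷-Empty
length-disjointFrom {suc p} (x ∷ s) (suc k) = begin
  length (filter (disjointFrom? (x ∷ s)) (with0 ++ without0))
    ≡⟨ cong length (filter-++ (disjointFrom? (x ∷ s)) with0 without0) ⟩
  length (filter (disjointFrom? (x ∷ s)) with0 ++ filter (disjointFrom? (x ∷ s)) without0)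
    ≡⟨ length-++ (filter (disjointFrom? (x ∷ s)) with0) ⟩
  length (filter (disjointFrom? (x ∷ s)) with0) + length (filter (disjointFrom? (x ∷ s)) without0)
    ≡⟨ split x ⟩
  (suc p ∸ ∣ x ∷ s ∣) C suc k ∎
  where
  with0    = map with-zero (kSubsets p k)
  without0 = map without-zero (kSubsets p (suc k))

  without-zero-count : ∀ x → DisjointFrom (x ∷ s) ∘ without-zero ≐ DisjointFrom {k = suc k} s →
    length (filter (disjointFrom? (x ∷ s)) without0) ≡ (p ∸ ∣ s ∣) C suc k
  without-zero-count x eqv = trans
    (length-filter-map (disjointFrom? (x ∷ s)) (disjointFrom? s) without-zero eqv (kSubsets p (suc k)))
    (length-disjointFrom s (suc k))

  split : ∀ x →
    length (filter (disjointFrom? (x ∷ s)) with0) + length (filter (disjointFrom? (x ∷ s)) without0)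
      ≡ (suc p ∸ ∣ x ∷ s ∣) C suc k
  -- Sets containing the first point meet `inside ∷ s` there, so the first count is 0;
  -- `suc p ∸ suc ∣ s ∣` reduces to `p ∸ ∣ s ∣`.
  split inside = cong₂ _+_
    (cong length (filter-none (disjointFrom? (inside ∷ s))
      (All.map⁺ (universal (λ _ e → e (_ , here)) (kSubsets p k)))))
    (without-zero-count inside (drop-∷-Empty , ∷-Empty))
  split outside = begin
    _ ≡⟨ cong₂ _+_
           (trans (length-filter-map (disjointFrom? (outside ∷ s)) (disjointFrom? s) with-zero
                     (drop-∷-Empty , ∷-Empty) (kSubsets p k))
                  (length-disjointFrom s k))
           (without-zero-count outside (drop-∷-Empty , ∷-Empty)) ⟩
    (p ∸ ∣ s ∣) C k + (p ∸ ∣ s ∣) C suc k ≡⟨ nCk+nC[k+1]≡[n+1]C[k+1] (p ∸ ∣ s ∣) k ⟩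
    -- Subtraction is truncated, so moving `suc` across it uses `∣ s ∣ ≤ p`.
    suc (p ∸ ∣ s ∣) C suc k               ≡⟨ cong (_C suc k) (+-∸-assoc 1 (∣p∣≤n s)) ⟨
    (suc p ∸ ∣ s ∣) C suc k               ∎

-- Every set is disjoint from the empty set, so the filter for `⊥` keeps the whole list.
length-kSubsets : ∀ p k → length (kSubsets p k) ≡ p C k
length-kSubsets p k = begin
  length (kSubsets p k)
    ≡⟨ cong length (filter-all (disjointFrom? (Subset.⊥ {p})) (universal disjoint⊥ (kSubsets p k))) ⟨
  length (filter (disjointFrom? (Subset.⊥ {p})) (kSubsets p k))
    ≡⟨ length-disjointFrom (Subset.⊥ {p}) k ⟩
  (p ∸ ∣ Subset.⊥ {p} ∣) C k
    ≡⟨ cong (λ m → (p ∸ m) C k) (∣⊥∣≡0 p) ⟩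
  p C k ∎
  where
  disjoint⊥ : ∀ (t : KSubset p k) → DisjointFrom Subset.⊥ t
  disjoint⊥ (t , _) = subst Empty (sym (∩-zeroˡ t)) λ (_ , i∈⊥) → ∉⊥ i∈⊥

kneser-degree : ∀ p k (u : KSubset p k) →
                length (filter (disjointFrom? (proj₁ u)) (kSubsets p k)) ≡ (p ∸ k) C k
kneser-degree p k (s , refl) = length-disjointFrom s k

-- In unnormalised rationals equality is cross-multiplication, which here is `a * n ≡ b * c` up to
-- factors 1; both sides are moved there and back.
/1≡*/ : ∀ a b c n .{{_ : NonZero n}} → a * n ≡ b * c →
        (+ a) / 1 ≡ ((+ b) / 1) *ℚ ((+ c) / n)
/1≡*/ a b c (suc n) eq = toℚᵘ-injective $
  -- `mkℚᵘ` stores the denominator minus one: `0` encodes 1, and `n` below encodes `suc n`.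
  ℚᵘ.≃-trans (toℚᵘ-fromℚᵘ (mkℚᵘ (+ a) 0)) $
  ℚᵘ.≃-trans (*≡* cross) $
  ℚᵘ.≃-sym $
  ℚᵘ.≃-trans (toℚᵘ-homo-* ((+ b) / 1) ((+ c) / suc n)) $
  ℚᵘ.*-cong (toℚᵘ-fromℚᵘ (mkℚᵘ (+ b) 0)) (toℚᵘ-fromℚᵘ (mkℚᵘ (+ c) n))
  where
  cross : + a *ℤ + (1 * suc n) ≡ (+ b *ℤ + c) *ℤ + 1
  cross = begin
    + a *ℤ + (1 * suc n) ≡⟨ pos-* a (1 * suc n) ⟨
    + (a * (1 * suc n))  ≡⟨ cong (λ m → + (a * m)) (*-identityˡ (suc n)) ⟩
    + (a * suc n)        ≡⟨ cong +_ eq ⟩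
    + (b * c)            ≡⟨ cong +_ (*-identityʳ (b * c)) ⟨
    + (b * c * 1)        ≡⟨ pos-* (b * c) 1 ⟩
    + (b * c) *ℤ + 1     ≡⟨ cong (_*ℤ + 1) (pos-* b c) ⟩
    (+ b *ℤ + c) *ℤ + 1  ∎

proposition3p9 : ∀ (p k : ℕ) (1≤k : 1 ≤ k) (2k≤p : 2 * k ≤ p)
    (conn : Connected (KG p k 1≤k)) →
    let W = wienerIndex (KG p k 1≤k) conn in
    S₁ (KG p k 1≤k) conn ≡ 2 * W * ((p ∸ k) C k)
    × (+ S₂ (KG p k 1≤k) conn) / 1
    ≡ ((+ ((p ∸ k) C k)) / 1) *ℚ ((+ (2 * W ^ 2)) / (p C k)) {{C-nonZero p k 2k≤p}}
proposition3p9 p k 1≤k 2k≤p conn =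
    S₁-regular G conn status≡c (kneser-degree p k)
  , /1≡*/ (S₂ G conn) ((p ∸ k) C k) (2 * wienerIndex G conn ^ 2) (p C k) {{C-nonZero p k 2k≤p}}
      (subst (λ N → S₂ G conn * N ≡ ((p ∸ k) C k) * (2 * wienerIndex G conn ^ 2))
        (length-kSubsets p k) (S₂-regular G conn status≡c (kneser-degree p k)))
  where
  G = KG p k 1≤k
  -- A reference vertex whose status serves as the common constant; it exists because `p C k` is
  -- nonzero.
  u₀ : KSubset p k
  u₀ = head-of-nonempty (kSubsets p k)
         (subst NonZero (sym (length-kSubsets p k)) (C-nonZero p k 2k≤p))
  status≡c : ∀ u → status G conn u ≡ status G conn u₀
  status≡c u = kneser-status 1≤k conn u u₀
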